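{- Computability is stable over the structure $\langle\mathbb{Q},+,\times\rangle$ of the rational numbers with addition and multiplication.
   Context: Computability over natural numbers is the usual one. A set $A \subseteq \mathbb{N}$ is effectively enumerable if it is empty or the image of a total computable function from $\mathbb{N}$ to $\mathbb{N}$. For $A \subseteq \mathbb{N}^m$ and $B \subseteq \mathbb{N}$, a computable function from $A$ to $B$ is a partial computable function that is defined at every element of $A$ and takes values in $B$ there. Indexing: an indexing of a set $E$ is a partial function $i$ from $\mathbb{N}$ to $E$ such that $dom(i)$ is effectively enumerable, $i$ is surjective, and there is a computable function $eq$ from $dom(i)\times dom(i)$ to $\{0,1\}$ with $eq(x,y)=1$ if $i(x)=i(y)$ and $eq(x,y)=0$ otherwise. An indexing $i$ of the set $E$ is an admissible indexing of a one-sorted structure $\langle E,op_1,\ldots,op_p\rangle$ if every operation $op: E^m\to E$ among $op_1,\ldots,op_p$ is computable relatively to $i$, that is, there is a computable function $\hat{op}$ from $dom(i)^m$ to $dom(i)$ such that $i(\hat{op}(x_1,\ldots,x_m)) = op(i(x_1),\ldots,i(x_m))$ for all $x_1,\ldots,x_m\in dom(i)$. Computability is stable over $\langle E,op_1,\ldots,op_p\rangle$ if there exists an admissible indexing of this structure and, for all admissible indexings $j$ and $j'$ of it, there exists a computable function $h$ from $dom(j')$ to $dom(j)$ such that $j' = j\circ h$. -}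

module Defs where

open import Data.Fin using (Fin)
open import Data.List using (List; []; _∷_)
import Data.List.Relation.Unary.All as List
open import Data.Nat using (ℕ; suc; _<_)
open import Data.Nat.Properties using (<-cmp)
open import Data.Product using (∃-syntax; _×_; _,_)
open import Data.Rational using (ℚ; _+_; _*_)
open import Data.Sum using (_⊎_)
open import Data.Vec using (Vec; []; _∷_; lookup; [_])
open import Data.Vec.Relation.Binary.Pointwise.Inductive using (Pointwise; []; _∷_)
import Data.Vec.Relation.Unary.All as Vec
open import Function.Bundles using (_⇔_)
open import Level using (0ℓ)
open import Relation.Binary.Definitions using (tri<; tri≈; tri>)
open import Relation.Binary.PropositionalEquality using (_≡_; _≢_; refl)
open import Relation.Unary using (Pred; _∈_; Empty)

private
  variable
    m n : ℕ

-- Programs for the partial recursive (= partial computable) functions ℕⁿ ⇀ ℕ.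
data Code : ℕ → Set where
  zero : Code n
  succ : Code 1
  proj : Fin n → Code n
  comp : Code m → Vec (Code n) m → Code n
  prec : Code n → Code (suc (suc n)) → Code (suc n)
  mu   : Code (suc n) → Code n

infix 4 _∙_↦_

-- f ∙ xs ↦ y : the partial function computed by f is defined at xs, with value y.
-- In prec f g the recursion variable is the first argument, and the step g
-- receives the predecessor, the recursive value and the parameters.
data _∙_↦_ : Code n → Vec ℕ n → ℕ → Set where
  zero↦  : {xs : Vec ℕ n} → zero ∙ xs ↦ 0
  succ↦  : ∀ {x} → succ ∙ [ x ] ↦ suc x
  proj↦  : ∀ {xs : Vec ℕ n} {i} → proj i ∙ xs ↦ lookup xs i
  comp↦  : ∀ {f : Code m} {gs : Vec (Code n) m} {xs ys z} →
           Pointwise (λ g y → g ∙ xs ↦ y) gs ys →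
           f ∙ ys ↦ z →
           comp f gs ∙ xs ↦ z
  prec↦₀ : ∀ {f : Code n} {g xs y} →
           f ∙ xs ↦ y →
           prec f g ∙ 0 ∷ xs ↦ y
  prec↦ₛ : ∀ {f : Code n} {g k xs y z} →
           prec f g ∙ k ∷ xs ↦ y →
           g ∙ k ∷ y ∷ xs ↦ z →
           prec f g ∙ suc k ∷ xs ↦ z
  mu↦    : ∀ {f : Code (suc n)} {xs y} →
           f ∙ y ∷ xs ↦ 0 →
           (∀ z → z < y → ∃[ v ] f ∙ z ∷ xs ↦ suc v) →
           mu f ∙ xs ↦ y

mutual
  ↦-functional : ∀ {f : Code n} {xs y y′} → f ∙ xs ↦ y → f ∙ xs ↦ y′ → y ≡ y′
  ↦-functional zero↦ zero↦ = refl
  ↦-functional succ↦ succ↦ = refl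
  ↦-functional proj↦ proj↦ = refl
  ↦-functional (comp↦ ps p) (comp↦ qs q) with refl ← ↦-functional* ps qs = ↦-functional p q
  ↦-functional (prec↦₀ p) (prec↦₀ q) = ↦-functional p q
  ↦-functional (prec↦ₛ p p′) (prec↦ₛ q q′) with refl ← ↦-functional p q = ↦-functional p′ q′
  ↦-functional (mu↦ {y = y} p p<) (mu↦ {y = y′} q q<) with <-cmp y y′
  ... | tri≈ _ y≡y′ _ = y≡y′
  ... | tri< y<y′ _ _ with _ , r ← q< y y<y′ with () ← ↦-functional p r
  ... | tri> _ _ y′<y with _ , r ← p< y′ y′<y with () ← ↦-functional r q

  ↦-functional* : ∀ {gs : Vec (Code n) m} {xs ys ys′} →
                  Pointwise (λ g y → g ∙ xs ↦ y) gs ys →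
                  Pointwise (λ g y → g ∙ xs ↦ y) gs ys′ → ys ≡ ys′
  ↦-functional* [] [] = refl
  ↦-functional* (p ∷ ps) (q ∷ qs) with refl ← ↦-functional p q with refl ← ↦-functional* ps qs = refl

infix 4 _∶_⟶_

-- f is a computable function from A to B; its behaviour outside A is unconstrained.
_∶_⟶_ : Code m → Pred (Vec ℕ m) 0ℓ → Pred ℕ 0ℓ → Set
f ∶ A ⟶ B = ∀ xs → xs ∈ A → ∃[ y ] f ∙ xs ↦ y × y ∈ B

_^_ : Pred ℕ 0ℓ → (m : ℕ) → Pred (Vec ℕ m) 0ℓ
(A ^ m) xs = Vec.All A xs

Total : Code 1 → Set
Total f = ∀ x → ∃[ y ] f ∙ [ x ] ↦ y

EffectivelyEnumerable : Pred ℕ 0ℓ → Set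
EffectivelyEnumerable A =
  Empty A ⊎ ∃[ f ] Total f × (∀ y → y ∈ A ⇔ (∃[ x ] f ∙ [ x ] ↦ y))

-- Partial functions from ℕ to E are given by their graphs.
Dom : {E : Set} → (ℕ → E → Set) → Pred ℕ 0ℓ
Dom i x = ∃[ e ] i x e

-- (i ⊙ f) xs e : the composite partial function i ∘ f is defined at xs, with value e.
_⊙_ : {E : Set} → (ℕ → E → Set) → Code m → Vec ℕ m → E → Set
(i ⊙ f) xs e = ∃[ y ] f ∙ xs ↦ y × i y e

record IsIndexing {E : Set} (i : ℕ → E → Set) : Set where
  field
    functional : ∀ {x e e′} → i x e → i x e′ → e ≡ e′
    enumerable : EffectivelyEnumerable (Dom i)
    surjective : ∀ e → ∃[ x ] i x e
    eq         : Code 2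
    eq-maps    : eq ∶ Dom i ^ 2 ⟶ (λ v → v ≡ 0 ⊎ v ≡ 1)
    eq-true    : ∀ {x y d e} → i x d → i y e → d ≡ e → eq ∙ x ∷ y ∷ [] ↦ 1
    eq-false   : ∀ {x y d e} → i x d → i y e → d ≢ e → eq ∙ x ∷ y ∷ [] ↦ 0

Operation : Set → Set
Operation E = ∃[ m ] (Vec E m → E)

record Structure : Set₁ where
  constructor ⟨_,_⟩
  field
    Carrier    : Set
    operations : List (Operation Carrier)

ComputableRelativelyTo : {E : Set} → (ℕ → E → Set) → Operation E → Set
ComputableRelativelyTo i (m , op) =
  ∃[ f ] f ∶ Dom i ^ m ⟶ Dom i ×
         (∀ {xs es} → Pointwise i xs es → (i ⊙ f) xs (op es))

record IsAdmissible (S : Structure) (i : ℕ → Structure.Carrier S → Set) : Set where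
  open Structure S
  field
    isIndexing : IsIndexing i
    computable : List.All (ComputableRelativelyTo i) operations

-- j′ = j ∘ h is an equality of partial functions, so it includes equality of domains.
ComputabilityStable : Structure → Set₁
ComputabilityStable S =
  (∃[ i ] IsAdmissible S i) ×
  (∀ j j′ → IsAdmissible S j → IsAdmissible S j′ →
   ∃[ h ] h ∶ Dom j′ ^ 1 ⟶ Dom j × (∀ x e → j′ x e ⇔ (j ⊙ h) [ x ] e))

binary : {E : Set} → (E → E → E) → Operation E
binary _⊕_ = 2 , λ { (x ∷ y ∷ []) → x ⊕ y }

ℚ-+-× : Structure
ℚ-+-× = ⟨ ℚ , binary _+_ ∷ binary _*_ ∷ [] ⟩

{-# OPTIONS --safe #-}

-- Every rational is (a − b) / (c + 1) for some naturals a, b, c. Through the Cantor pairing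
-- function this yields an admissible indexing. Conversely, q = (a − b) / (c + 1) holds exactly
-- when q (c + 1) + b = a, an equation which any admissible indexing can test, since it computes
-- sums, products and indices of the naturals. Hence, to translate an index x from j′ to j, first
-- wait until x is enumerated in the domain of j′ (so that the translation diverges outside it),
-- then search for a, b, c and an index y of j such that x in j′ and y in j both satisfy
-- the equation.
module Submission where

open import Defs
open import Algebra.Bundles using (AbelianGroup)
import Algebra.Properties.Group as Group
open import Data.Fin using (Fin; zero; suc)
open import Data.Integer as ℤ using (+_; -[1+_])
import Data.Integer.Properties as ℤ
open import Data.Integer.Tactic.RingSolver using (solve-∀)
import Data.List.Relation.Unary.All as List
open import Data.List.Relation.Unary.All using ([]; _∷_)
open import Data.Nat as ℕ using (ℕ; zero; suc; pred; _∸_; ∣_-_∣; _≤_; _<_)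
import Data.Nat.Properties as ℕ
open import Data.Product using (∃-syntax; _×_; _,_; proj₁; proj₂)
open import Data.Rational as ℚ using (ℚ; mkℚ; 0ℚ; 1ℚ; _+_; _*_; toℚᵘ; fromℚᵘ)
import Data.Rational.Properties as ℚ
open import Data.Rational.Unnormalised as ℚᵘ using (ℚᵘ; mkℚᵘ; *≡*)
import Data.Rational.Unnormalised.Properties as ℚᵘ
open import Data.Sum using (_⊎_; inj₁; inj₂)
open import Data.Vec using (Vec; []; _∷_; [_]; lookup)
open import Data.Vec.Relation.Binary.Pointwise.Inductive using ([]; _∷_)
open import Data.Vec.Relation.Unary.All using ([]; _∷_)
open import Function using (_∘_; _$_; _⇔_; mk⇔; Equivalence)
open import Relation.Binary.PropositionalEquality
  using (_≡_; _≢_; refl; sym; trans; cong; cong₂; subst; module ≡-Reasoning)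
open import Relation.Nullary using (Dec; yes; no; contradiction)

private
  variable
    n : ℕ
    E : Set

-- Total computable functions

record Computable (f : Vec ℕ n → ℕ) : Set where
  constructor computable
  field
    code     : Code n
    computes : ∀ xs → code ∙ xs ↦ f xs

record Computable₁ (f : ℕ → ℕ) : Set where
  constructor computable₁
  field
    code     : Code 1
    computes : ∀ x → code ∙ [ x ] ↦ f x

record Computable₂ (f : ℕ → ℕ → ℕ) : Set where
  constructor computable₂
  field
    code     : Code 2
    computes : ∀ x y → code ∙ x ∷ y ∷ [] ↦ f x y

curry₁ : {f : Vec ℕ 1 → ℕ} → Computable f → Computable₁ (λ x → f [ x ])
curry₁ (computable c p) = computable₁ c λ x → p [ x ]

curry₂ : {f : Vec ℕ 2 → ℕ} → Computable f → Computable₂ (λ x y → f (x ∷ y ∷ []))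
curry₂ (computable c p) = computable₂ c λ x y → p (x ∷ y ∷ [])

var : (i : Fin n) → Computable (λ xs → lookup xs i)
var i = computable (proj i) λ _ → proj↦

apply₁ : ∀ {f} {g : Vec ℕ n → ℕ} → Computable₁ f → Computable g → Computable (λ xs → f (g xs))
apply₁ (computable₁ c p) (computable d q) =
  computable (comp c (d ∷ [])) λ xs → comp↦ (q xs ∷ []) (p _)

apply₂ : ∀ {f} {g h : Vec ℕ n → ℕ} → Computable₂ f → Computable g → Computable h →
         Computable (λ xs → f (g xs) (h xs))
apply₂ (computable₂ c p) (computable d q) (computable e r) =
  computable (comp c (d ∷ e ∷ [])) λ xs → comp↦ (q xs ∷ r xs ∷ []) (p _ _)

suc-computable : Computable₁ suc
suc-computable = computable₁ succ λ _ → succ↦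

const-computable : ∀ k → Computable {n} (λ _ → k)
const-computable zero    = computable zero λ _ → zero↦
const-computable (suc k) = apply₁ suc-computable (const-computable k)

-- The target `h` is given in advance and the two equations say that `f` and `g` follow it, so a
-- function already defined by other means can be shown computable as it stands.
prec-computes : ∀ {f g} (h : ℕ → Vec ℕ n → ℕ) (F : Computable f) (G : Computable g) →
                (∀ xs → f xs ≡ h 0 xs) → (∀ k xs → g (k ∷ h k xs ∷ xs) ≡ h (suc k) xs) →
                ∀ k xs → prec (Computable.code F) (Computable.code G) ∙ k ∷ xs ↦ h k xs
prec-computes h (computable c p) G eq₀ eqₛ zero xs =
  subst (prec c _ ∙ 0 ∷ xs ↦_) (eq₀ xs) (prec↦₀ (p xs))
prec-computes h F G@(computable d q) eq₀ eqₛ (suc k) xs =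
  subst (prec _ d ∙ suc k ∷ xs ↦_) (eqₛ k xs)
        (prec↦ₛ (prec-computes h F G eq₀ eqₛ k xs) (q (k ∷ h k xs ∷ xs)))

recursion₁ : (h : ℕ → ℕ) {g : Vec ℕ 2 → ℕ} → Computable g →
             (∀ k → g (k ∷ h k ∷ []) ≡ h (suc k)) → Computable₁ h
recursion₁ h G eqₛ = computable₁ _ λ k →
  prec-computes (λ k _ → h k) (const-computable (h 0)) G (λ _ → refl) (λ { k [] → eqₛ k }) k []

recursion₂ : (h : ℕ → ℕ → ℕ) {f : Vec ℕ 1 → ℕ} {g : Vec ℕ 3 → ℕ} → Computable f → Computable g →
             (∀ x → f [ x ] ≡ h 0 x) → (∀ k x → g (k ∷ h k x ∷ x ∷ []) ≡ h (suc k) x) →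
             Computable₂ h
recursion₂ h F G eq₀ eqₛ = computable₂ _ λ k x →
  prec-computes (λ { k (x ∷ []) → h k x }) F G
                (λ { (x ∷ []) → eq₀ x }) (λ { k (x ∷ []) → eqₛ k x }) k [ x ]

flip-computable : ∀ {f} → Computable₂ f → Computable₂ (λ x y → f y x)
flip-computable F = curry₂ (apply₂ F (var (suc zero)) (var zero))

-- Arithmetic by primitive recursion

infixl 6 _+ᶜ_
infixl 7 _*ᶜ_

+-computable : Computable₂ ℕ._+_
+-computable = recursion₂ ℕ._+_ (var zero) (apply₁ suc-computable (var (suc zero)))
                          (λ _ → refl) (λ _ _ → refl)

_+ᶜ_ : {f g : Vec ℕ n → ℕ} → Computable f → Computable g → Computable (λ xs → f xs ℕ.+ g xs)
_+ᶜ_ = apply₂ +-computable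

*-computable : Computable₂ ℕ._*_
*-computable = recursion₂ ℕ._*_ (const-computable 0) (var (suc (suc zero)) +ᶜ var (suc zero))
                          (λ _ → refl) (λ _ _ → refl)

_*ᶜ_ : {f g : Vec ℕ n → ℕ} → Computable f → Computable g → Computable (λ xs → f xs ℕ.* g xs)
_*ᶜ_ = apply₂ *-computable

pred-computable : Computable₁ pred
pred-computable = recursion₁ pred (var zero) (λ _ → refl)

∸-computable : Computable₂ _∸_
∸-computable = flip-computable $
  -- The recursion runs on the number subtracted, while `prec` recurses on its first argument; hence
  -- the flip.
  recursion₂ (λ k x → x ∸ k) (var zero) (apply₁ pred-computable (var (suc zero)))
             (λ _ → refl) (λ k x → ℕ.pred[m∸n]≡m∸[1+n] x k)

-- At least one of the two truncated differences vanishes. This reduces the distance to functions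
-- already shown computable.
[m∸n]+[n∸m]≡∣m-n∣ : ∀ m n → (m ∸ n) ℕ.+ (n ∸ m) ≡ ∣ m - n ∣
[m∸n]+[n∸m]≡∣m-n∣ zero    zero    = refl
[m∸n]+[n∸m]≡∣m-n∣ zero    (suc n) = refl
[m∸n]+[n∸m]≡∣m-n∣ (suc m) zero    = ℕ.+-identityʳ (suc m)
[m∸n]+[n∸m]≡∣m-n∣ (suc m) (suc n) = [m∸n]+[n∸m]≡∣m-n∣ m n

distance-computable : Computable₂ ∣_-_∣
distance-computable = computable₂ (code F) λ x y →
  subst (code F ∙ x ∷ y ∷ [] ↦_) ([m∸n]+[n∸m]≡∣m-n∣ x y) (computes F x y)
  where
  open Computable₂
  F : Computable₂ (λ x y → (x ∸ y) ℕ.+ (y ∸ x))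
  F = curry₂ (apply₂ ∸-computable (var zero) (var (suc zero)) +ᶜ
              apply₂ ∸-computable (var (suc zero)) (var zero))

isZero : ℕ → ℕ
isZero zero    = 1
isZero (suc _) = 0

isZero-computable : Computable₁ isZero
isZero-computable = recursion₁ isZero (const-computable 0) (λ _ → refl)

isEqual : ℕ → ℕ → ℕ
isEqual m n = isZero ∣ m - n ∣

isEqual-computable : Computable₂ isEqual
isEqual-computable =
  curry₂ (apply₁ isZero-computable (apply₂ distance-computable (var zero) (var (suc zero))))

isEqual-01 : ∀ m n → isEqual m n ≡ 0 ⊎ isEqual m n ≡ 1
isEqual-01 m n with ∣ m - n ∣
... | zero  = inj₂ refl
... | suc _ = inj₁ refl

isEqual-true : ∀ {m n} → m ≡ n → isEqual m n ≡ 1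
isEqual-true m≡n = cong isZero (ℕ.m≡n⇒∣m-n∣≡0 m≡n)

isEqual-false : ∀ {m n} → m ≢ n → isEqual m n ≡ 0
isEqual-false {m} {n} m≢n with ∣ m - n ∣ in eq
... | zero  = contradiction (ℕ.∣m-n∣≡0⇒m≡n eq) m≢n
... | suc _ = refl

-- As `f` is total, every value below the least zero can be computed and seen to be nonzero. The
-- walk upwards from 0 meets that zero at `k` at the latest.
mu-defined : {f : Vec ℕ (suc n) → ℕ} (F : Computable f) → ∀ xs k → f (k ∷ xs) ≡ 0 →
             ∃[ y ] mu (Computable.code F) ∙ xs ↦ y
mu-defined {f = f} (computable c p) xs k fk≡0 = search k 0 (λ _ ()) (ℕ.+-identityʳ k)
  where
  nonzero-below : ℕ → Set
  nonzero-below y = ∀ z → z < y → ∃[ v ] c ∙ z ∷ xs ↦ suc v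

  extend : ∀ {y v} → f (y ∷ xs) ≡ suc v → nonzero-below y → nonzero-below (suc y)
  extend {y} eq below z z<1+y with ℕ.m≤n⇒m<n∨m≡n (ℕ.s≤s⁻¹ z<1+y)
  ... | inj₁ z<y  = below z z<y
  ... | inj₂ refl = _ , subst (c ∙ y ∷ xs ↦_) eq (p (y ∷ xs))

  -- `fuel` is the distance from `y` to the known zero `k`; when it runs out, `y` is `k` and a
  -- nonzero value is absurd.
  search : ∀ fuel y → nonzero-below y → fuel ℕ.+ y ≡ k → ∃[ y ] mu c ∙ xs ↦ y
  search fuel y below eq with f (y ∷ xs) in fy
  search fuel y below eq | zero = y , mu↦ (subst (c ∙ y ∷ xs ↦_) fy (p (y ∷ xs))) below
  search zero y below refl | suc v = contradiction (trans (sym fk≡0) fy) λ ()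
  search (suc fuel) y below eq | suc v =
    search fuel (suc y) (extend fy below) (trans (ℕ.+-suc fuel y) eq)

mu-sound : {f : Vec ℕ (suc n) → ℕ} (F : Computable f) → ∀ {xs y} →
           mu (Computable.code F) ∙ xs ↦ y → f (y ∷ xs) ≡ 0
mu-sound (computable c p) (mu↦ q _) = ↦-functional (p _) q

-- Cantor pairing

triangle : ℕ → ℕ
triangle zero    = 0
triangle (suc n) = suc n ℕ.+ triangle n

-- The n with triangle n ≤ k < triangle (suc n).
diagonal : ℕ → ℕ
diagonal zero    = 0
diagonal (suc k) = diagonal k ℕ.+ isEqual (triangle (suc (diagonal k))) (suc k)

-- The step from `n + triangle n`, the last entry of diagonal `n`, leads to `triangle (suc n)`,
-- where the equality test adds 1. At any later entry `suc a + triangle n` with `a < n` the next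
-- triangular number is not yet reached, and the test adds 0.
diagonal-≤ : ∀ n a → a ≤ n → diagonal (a ℕ.+ triangle n) ≡ n
diagonal-≤ zero    zero    _   = refl
diagonal-≤ (suc n) zero    _
  rewrite diagonal-≤ n n ℕ.≤-refl
        | isEqual-true {triangle (suc n)} refl = ℕ.+-comm n 1
diagonal-≤ n       (suc a) a<n
  rewrite diagonal-≤ n a (ℕ.<⇒≤ a<n)
        | isEqual-false {triangle (suc n)} {suc a ℕ.+ triangle n}
            (λ eq → ℕ.>⇒≢ a<n (ℕ.suc-injective (ℕ.+-cancelʳ-≡ (triangle n) (suc n) (suc a) eq)))
        = ℕ.+-identityʳ n

triangle-computable : Computable₁ triangle
triangle-computable =
  recursion₁ triangle (apply₁ suc-computable (var zero) +ᶜ var (suc zero)) (λ _ → refl)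

diagonal-computable : Computable₁ diagonal
diagonal-computable = recursion₁ diagonal
  (var (suc zero) +ᶜ
   apply₂ isEqual-computable
     (apply₁ triangle-computable (apply₁ suc-computable (var (suc zero))))
     (apply₁ suc-computable (var zero)))
  (λ _ → refl)

-- A pair is the entry at position `a` of the diagonal `a + b`. Afterwards only the two projection
-- laws and computability are used.
abstract
  pair : ℕ → ℕ → ℕ
  pair a b = a ℕ.+ triangle (a ℕ.+ b)

  left : ℕ → ℕ
  left k = k ∸ triangle (diagonal k)

  right : ℕ → ℕ
  right k = diagonal k ∸ left k

  diagonal-pair : ∀ a b → diagonal (pair a b) ≡ a ℕ.+ b
  diagonal-pair a b = diagonal-≤ (a ℕ.+ b) a (ℕ.m≤m+n a b)

  left-pair : ∀ a b → left (pair a b) ≡ a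
  left-pair a b rewrite diagonal-pair a b = ℕ.m+n∸n≡m a (triangle (a ℕ.+ b))

  right-pair : ∀ a b → right (pair a b) ≡ b
  right-pair a b rewrite left-pair a b | diagonal-pair a b = ℕ.m+n∸m≡n a b

  pair-computable : Computable₂ pair
  pair-computable =
    curry₂ (var zero +ᶜ apply₁ triangle-computable (var zero +ᶜ var (suc zero)))

  left-computable : Computable₁ left
  left-computable = curry₁ $
    apply₂ ∸-computable (var zero)
                        (apply₁ triangle-computable (apply₁ diagonal-computable (var zero)))

  right-computable : Computable₁ right
  right-computable = curry₁ $
    apply₂ ∸-computable (apply₁ diagonal-computable (var zero)) (apply₁ left-computable (var zero))

-- Fractions

-- A difference of naturals avoids encoding a sign, and `mkℚᵘ` stores the denominator less one, so
-- every triple of naturals is a valid fraction.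
fractionᵘ : ℕ → ℕ → ℕ → ℚᵘ
fractionᵘ a b c = mkℚᵘ (+ a ℤ.- + b) c

fraction : ℕ → ℕ → ℕ → ℚ
fraction a b c = fromℚᵘ (fractionᵘ a b c)

natural : ℕ → ℚ
natural k = fromℚᵘ (mkℚᵘ (+ k) 0)

fraction-surjective : ∀ q → ∃[ a ] ∃[ b ] ∃[ c ] q ≡ fraction a b c
fraction-surjective q@(mkℚ (+ a) c _) = a , 0 , c ,
  trans (sym (ℚ.fromℚᵘ-toℚᵘ q)) (cong (λ z → fromℚᵘ (mkℚᵘ z c)) (sym (ℤ.+-identityʳ (+ a))))
fraction-surjective q@(mkℚ -[1+ b ] c _) = 0 , suc b , c , sym (ℚ.fromℚᵘ-toℚᵘ q)

-- This lets sums be computed on unnormalised representatives, without reduction to lowest terms.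
fromℚᵘ-homo-+ : ∀ p q → fromℚᵘ p + fromℚᵘ q ≡ fromℚᵘ (p ℚᵘ.+ q)
fromℚᵘ-homo-+ p q = ℚ.toℚᵘ-injective (begin
  toℚᵘ (fromℚᵘ p + fromℚᵘ q)              ≈⟨ ℚ.toℚᵘ-homo-+ (fromℚᵘ p) (fromℚᵘ q) ⟩
  toℚᵘ (fromℚᵘ p) ℚᵘ.+ toℚᵘ (fromℚᵘ q)    ≈⟨ ℚᵘ.+-cong (ℚ.toℚᵘ-fromℚᵘ p) (ℚ.toℚᵘ-fromℚᵘ q) ⟩
  p ℚᵘ.+ q                                ≈⟨ ℚ.toℚᵘ-fromℚᵘ (p ℚᵘ.+ q) ⟨
  toℚᵘ (fromℚᵘ (p ℚᵘ.+ q))                ∎)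
  where open ℚᵘ.≃-Reasoning

fromℚᵘ-homo-* : ∀ p q → fromℚᵘ p * fromℚᵘ q ≡ fromℚᵘ (p ℚᵘ.* q)
fromℚᵘ-homo-* p q = ℚ.toℚᵘ-injective (begin
  toℚᵘ (fromℚᵘ p * fromℚᵘ q)              ≈⟨ ℚ.toℚᵘ-homo-* (fromℚᵘ p) (fromℚᵘ q) ⟩
  toℚᵘ (fromℚᵘ p) ℚᵘ.* toℚᵘ (fromℚᵘ q)    ≈⟨ ℚᵘ.*-cong (ℚ.toℚᵘ-fromℚᵘ p) (ℚ.toℚᵘ-fromℚᵘ q) ⟩
  p ℚᵘ.* q                                ≈⟨ ℚ.toℚᵘ-fromℚᵘ (p ℚᵘ.* q) ⟨
  toℚᵘ (fromℚᵘ (p ℚᵘ.* q))                ∎)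
  where open ℚᵘ.≃-Reasoning

-- The inductive step for reaching every natural from 0 by repeated addition of 1 inside the
-- structure.
natural-suc : ∀ k → natural k + 1ℚ ≡ natural (suc k)
natural-suc k = trans (fromℚᵘ-homo-+ (mkℚᵘ (+ k) 0) (mkℚᵘ (+ 1) 0))
                      (cong (λ z → fromℚᵘ (mkℚᵘ z 0)) numerator)
  where
  numerator : + k ℤ.* + 1 ℤ.+ + 1 ℤ.* + 1 ≡ + suc k
  numerator = trans (cong (ℤ._+ + 1) (ℤ.*-identityʳ (+ k))) (cong +_ (ℕ.+-comm k 1))

pos-*+* : ∀ w x y z → + w ℤ.* + x ℤ.+ + y ℤ.* + z ≡ + (w ℕ.* x ℕ.+ y ℕ.* z)
pos-*+* w x y z = sym (trans (ℤ.pos-+ (w ℕ.* x) _) (cong₂ ℤ._+_ (ℤ.pos-* w x) (ℤ.pos-* y z)))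

-- Positive and negative parts are combined separately, so the resulting triple is computed within
-- the naturals; `pred` restores the convention of storing the denominator less one.
fraction-+ : ∀ a b c a′ b′ c′ → fraction a b c + fraction a′ b′ c′ ≡
  fraction (a ℕ.* suc c′ ℕ.+ a′ ℕ.* suc c) (b ℕ.* suc c′ ℕ.+ b′ ℕ.* suc c) (pred (suc c ℕ.* suc c′))
fraction-+ a b c a′ b′ c′ =
  trans (fromℚᵘ-homo-+ (fractionᵘ a b c) (fractionᵘ a′ b′ c′))
        (cong (λ z → fromℚᵘ (mkℚᵘ z _))
              (trans (ring (+ a) (+ b) (+ a′) (+ b′) (+ suc c) (+ suc c′))
                     (cong₂ ℤ._-_ (pos-*+* a (suc c′) a′ (suc c)) (pos-*+* b (suc c′) b′ (suc c)))))
  where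
  ring : ∀ a b a′ b′ d d′ → (a ℤ.- b) ℤ.* d′ ℤ.+ (a′ ℤ.- b′) ℤ.* d ≡
                            (a ℤ.* d′ ℤ.+ a′ ℤ.* d) ℤ.- (b ℤ.* d′ ℤ.+ b′ ℤ.* d)
  ring = solve-∀

fraction-* : ∀ a b c a′ b′ c′ → fraction a b c * fraction a′ b′ c′ ≡
  fraction (a ℕ.* a′ ℕ.+ b ℕ.* b′) (a ℕ.* b′ ℕ.+ b ℕ.* a′) (pred (suc c ℕ.* suc c′))
fraction-* a b c a′ b′ c′ =
  trans (fromℚᵘ-homo-* (fractionᵘ a b c) (fractionᵘ a′ b′ c′))
        (cong (λ z → fromℚᵘ (mkℚᵘ z _))
              (trans (ring (+ a) (+ b) (+ a′) (+ b′))
                     (cong₂ ℤ._-_ (pos-*+* a a′ b b′) (pos-*+* a b′ b a′))))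
  where
  ring : ∀ a b a′ b′ → (a ℤ.- b) ℤ.* (a′ ℤ.- b′) ≡
                       (a ℤ.* a′ ℤ.+ b ℤ.* b′) ℤ.- (a ℤ.* b′ ℤ.+ b ℤ.* a′)
  ring = solve-∀

-- Serves to clear the subtracted terms of an integer equation: `o` is added to both sides, and
-- addition is cancellative.
+-shift-⇔ : ∀ {i j k l} o → i ℤ.+ o ≡ k → j ℤ.+ o ≡ l → (i ≡ j) ⇔ (k ≡ l)
+-shift-⇔ o refl refl =
  mk⇔ (cong (ℤ._+ o)) (Group.∙-cancelʳ (AbelianGroup.group ℤ.+-0-abelianGroup) o _ _)

fromℚᵘ-≡⇔ : ∀ p q → (fromℚᵘ p ≡ fromℚᵘ q) ⇔ (ℚᵘ.↥ p ℤ.* ℚᵘ.↧ q ≡ ℚᵘ.↥ q ℤ.* ℚᵘ.↧ p)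
fromℚᵘ-≡⇔ p q = mk⇔ (ℚᵘ.drop-*≡* ∘ ℚ.fromℚᵘ-injective {p} {q}) (ℚ.fromℚᵘ-cong {p} {q} ∘ *≡*)

-- Cross-multiplication, with subtracted terms moved to the opposite side. Only naturals remain, so
-- a code can test the equation.
fraction-≡⇔ : ∀ a b c a′ b′ c′ → (fraction a b c ≡ fraction a′ b′ c′) ⇔
              (a ℕ.* suc c′ ℕ.+ b′ ℕ.* suc c ≡ a′ ℕ.* suc c ℕ.+ b ℕ.* suc c′)
fraction-≡⇔ a b c a′ b′ c′ = mk⇔
  (λ eq → ℤ.+-injective (trans (sym lhs) (trans (to cross (to frac eq)) rhs)))
  (λ eq → from frac (from cross (trans lhs (trans (cong +_ eq) (sym rhs)))))
  where
  open Equivalence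
  frac = fromℚᵘ-≡⇔ (fractionᵘ a b c) (fractionᵘ a′ b′ c′)
  ringˡ : ∀ x y d y′ d′ → (x ℤ.- y) ℤ.* d′ ℤ.+ (y ℤ.* d′ ℤ.+ y′ ℤ.* d) ≡ x ℤ.* d′ ℤ.+ y′ ℤ.* d
  ringˡ = solve-∀
  ringʳ : ∀ y d x′ y′ d′ → (x′ ℤ.- y′) ℤ.* d ℤ.+ (y ℤ.* d′ ℤ.+ y′ ℤ.* d) ≡ x′ ℤ.* d ℤ.+ y ℤ.* d′
  ringʳ = solve-∀
  cross = +-shift-⇔ (+ b ℤ.* + suc c′ ℤ.+ + b′ ℤ.* + suc c)
                    (ringˡ (+ a) (+ b) (+ suc c) (+ b′) (+ suc c′))
                    (ringʳ (+ b) (+ suc c) (+ a′) (+ b′) (+ suc c′))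
  lhs = pos-*+* a (suc c′) b′ (suc c)
  rhs = pos-*+* a′ (suc c) b (suc c′)

-- With `q` written as `m / d`, the right side says `m (c + 1) = (a - b) d` and the left side
-- `m (c + 1) + b d = a d`; these differ by adding `b d` to both sides.
fraction-equation : ∀ q a b c → (q * natural (suc c) + natural b ≡ natural a) ⇔ (q ≡ fraction a b c)
fraction-equation q@(mkℚ m d-1 _) a b c = mk⇔
  (λ eq → trans (sym q≡)
            (from frac (from cross (trans (sym num≡) (trans (to equ (trans (sym lhs) eq)) den≡)))))
  (λ eq → trans lhs
            (from equ (trans num≡ (trans (to cross (to frac (trans q≡ eq))) (sym den≡)))))
  where
  open Equivalence
  p = toℚᵘ q
  d = + suc d-1
  sum = p ℚᵘ.* mkℚᵘ (+ suc c) 0 ℚᵘ.+ mkℚᵘ (+ b) 0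

  q≡ : fromℚᵘ p ≡ q
  q≡ = ℚ.fromℚᵘ-toℚᵘ q

  lhs : q * natural (suc c) + natural b ≡ fromℚᵘ sum
  lhs = trans (cong (λ r → r * natural (suc c) + natural b) (sym q≡))
       (trans (cong (_+ natural b) (fromℚᵘ-homo-* p (mkℚᵘ (+ suc c) 0)))
              (fromℚᵘ-homo-+ (p ℚᵘ.* mkℚᵘ (+ suc c) 0) (mkℚᵘ (+ b) 0)))

  frac = fromℚᵘ-≡⇔ p (fractionᵘ a b c)
  equ  = fromℚᵘ-≡⇔ sum (mkℚᵘ (+ a) 0)

  ring : ∀ a b d → (a ℤ.- b) ℤ.* d ℤ.+ b ℤ.* d ≡ a ℤ.* d
  ring = solve-∀

  cross : (m ℤ.* + suc c ≡ (+ a ℤ.- + b) ℤ.* d) ⇔ (m ℤ.* + suc c ℤ.+ + b ℤ.* d ≡ + a ℤ.* d)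
  cross = +-shift-⇔ (+ b ℤ.* d) refl (ring (+ a) (+ b) d)

  -- The naturals enter as fractions over 1; `num≡` and `den≡` strip the resulting factors of 1.
  num≡ : ℚᵘ.↥ sum ℤ.* + 1 ≡ m ℤ.* + suc c ℤ.+ + b ℤ.* d
  num≡ = trans (ℤ.*-identityʳ (ℚᵘ.↥ sum))
               (cong₂ ℤ._+_ (ℤ.*-identityʳ (m ℤ.* + suc c))
                            (cong (λ k → + b ℤ.* + k) (ℕ.*-identityʳ (suc d-1))))

  den≡ : + a ℤ.* ℚᵘ.↧ sum ≡ + a ℤ.* d
  den≡ = cong (λ k → + a ℤ.* + k) (trans (ℕ.*-identityʳ _) (ℕ.*-identityʳ (suc d-1)))

-- An admissible indexing

numerator⁺ numerator⁻ denominator-1 : ℕ → ℕ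
numerator⁺ k    = left k
numerator⁻ k    = left (right k)
denominator-1 k = right (right k)

decode : ℕ → ℚ
decode k = fraction (numerator⁺ k) (numerator⁻ k) (denominator-1 k)

encode : ℕ → ℕ → ℕ → ℕ
encode a b c = pair a (pair b c)

decode-encode : ∀ a b c → decode (encode a b c) ≡ fraction a b c
decode-encode a b c = begin
  decode (encode a b c)  ≡⟨ cong₂ decode-pair (left-pair a bc) (right-pair a bc) ⟩
  decode-pair a bc       ≡⟨ cong₂ (fraction a) (left-pair b c) (right-pair b c) ⟩
  fraction a b c         ∎
  where
  open ≡-Reasoning
  bc = pair b c
  decode-pair : ℕ → ℕ → ℚ
  decode-pair x y = fraction x (left y) (right y)

decode-surjective : ∀ q → ∃[ k ] decode k ≡ q
decode-surjective q with a , b , c , q≡ ← fraction-surjective q =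
  encode a b c , trans (decode-encode a b c) (sym q≡)

numerator⁺-computable : Computable₁ numerator⁺
numerator⁺-computable = left-computable

numerator⁻-computable : Computable₁ numerator⁻
numerator⁻-computable = curry₁ (apply₁ left-computable (apply₁ right-computable (var zero)))

denominator-1-computable : Computable₁ denominator-1
denominator-1-computable = curry₁ (apply₁ right-computable (apply₁ right-computable (var zero)))

encode-computable : {f g h : Vec ℕ n → ℕ} → Computable f → Computable g → Computable h →
                    Computable (λ xs → encode (f xs) (g xs) (h xs))
encode-computable F G H = apply₂ pair-computable F (apply₂ pair-computable G H)

-- One side of the equation in `fraction-≡⇔`; exchanging the arguments gives the other side.
crossProduct : ℕ → ℕ → ℕ
crossProduct k l =
  numerator⁺ k ℕ.* suc (denominator-1 l) ℕ.+ numerator⁻ l ℕ.* suc (denominator-1 k)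

sum : ℕ → ℕ → ℕ
sum k l = encode
  (numerator⁺ k ℕ.* suc (denominator-1 l) ℕ.+ numerator⁺ l ℕ.* suc (denominator-1 k))
  (numerator⁻ k ℕ.* suc (denominator-1 l) ℕ.+ numerator⁻ l ℕ.* suc (denominator-1 k))
  (pred (suc (denominator-1 k) ℕ.* suc (denominator-1 l)))

product : ℕ → ℕ → ℕ
product k l = encode
  (numerator⁺ k ℕ.* numerator⁺ l ℕ.+ numerator⁻ k ℕ.* numerator⁻ l)
  (numerator⁺ k ℕ.* numerator⁻ l ℕ.+ numerator⁻ k ℕ.* numerator⁺ l)
  (pred (suc (denominator-1 k) ℕ.* suc (denominator-1 l)))

decode-≡⇔ : ∀ k l → (decode k ≡ decode l) ⇔ (crossProduct k l ≡ crossProduct l k)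
decode-≡⇔ k l = fraction-≡⇔ (numerator⁺ k) (numerator⁻ k) (denominator-1 k)
                            (numerator⁺ l) (numerator⁻ l) (denominator-1 l)

decode-sum : ∀ k l → decode (sum k l) ≡ decode k + decode l
decode-sum k l = trans
  (decode-encode (numerator⁺ k ℕ.* suc (denominator-1 l) ℕ.+ numerator⁺ l ℕ.* suc (denominator-1 k))
                 (numerator⁻ k ℕ.* suc (denominator-1 l) ℕ.+ numerator⁻ l ℕ.* suc (denominator-1 k))
                 (pred (suc (denominator-1 k) ℕ.* suc (denominator-1 l))))
  (sym (fraction-+ (numerator⁺ k) (numerator⁻ k) (denominator-1 k)
                   (numerator⁺ l) (numerator⁻ l) (denominator-1 l)))

decode-product : ∀ k l → decode (product k l) ≡ decode k * decode l
decode-product k l = trans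
  (decode-encode (numerator⁺ k ℕ.* numerator⁺ l ℕ.+ numerator⁻ k ℕ.* numerator⁻ l)
                 (numerator⁺ k ℕ.* numerator⁻ l ℕ.+ numerator⁻ k ℕ.* numerator⁺ l)
                 (pred (suc (denominator-1 k) ℕ.* suc (denominator-1 l))))
  (sym (fraction-* (numerator⁺ k) (numerator⁻ k) (denominator-1 k)
                   (numerator⁺ l) (numerator⁻ l) (denominator-1 l)))

module _ where
  private
    a  = apply₁ numerator⁺-computable (var {2} zero)
    b  = apply₁ numerator⁻-computable (var {2} zero)
    d  = apply₁ suc-computable (apply₁ denominator-1-computable (var {2} zero))
    a′ = apply₁ numerator⁺-computable (var {2} (suc zero))
    b′ = apply₁ numerator⁻-computable (var {2} (suc zero))
    d′ = apply₁ suc-computable (apply₁ denominator-1-computable (var {2} (suc zero)))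

  sameFraction-computable : Computable₂ (λ k l → isEqual (crossProduct k l) (crossProduct l k))
  sameFraction-computable =
    curry₂ (apply₂ isEqual-computable (a *ᶜ d′ +ᶜ b′ *ᶜ d) (a′ *ᶜ d +ᶜ b *ᶜ d′))

  sum-computable : Computable₂ sum
  sum-computable = curry₂ $
    encode-computable (a *ᶜ d′ +ᶜ a′ *ᶜ d) (b *ᶜ d′ +ᶜ b′ *ᶜ d) (apply₁ pred-computable (d *ᶜ d′))

  product-computable : Computable₂ product
  product-computable = curry₂ $
    encode-computable (a *ᶜ a′ +ᶜ b *ᶜ b′) (a *ᶜ b′ +ᶜ b *ᶜ a′) (apply₁ pred-computable (d *ᶜ d′))

Decoding : ℕ → ℚ → Set
Decoding k q = decode k ≡ q

decoding-binary : ∀ {f} (op : ℚ → ℚ → ℚ) → Computable₂ f →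
                  (∀ k l → decode (f k l) ≡ op (decode k) (decode l)) →
                  ComputableRelativelyTo Decoding (binary op)
decoding-binary op (computable₂ c p) homo =
  c , (λ { (k ∷ l ∷ []) _ → _ , p k l , _ , refl }) ,
  λ { {k ∷ l ∷ []} (refl ∷ refl ∷ []) → _ , p k l , homo k l }

decoding-isAdmissible : IsAdmissible ℚ-+-× Decoding
decoding-isAdmissible = record
  { isIndexing = record
    { functional = λ { refl refl → refl }
    -- `decode` is total, so the domain is all of the naturals and the identity enumerates it.
    ; enumerable = inj₂ (proj zero , (λ x → x , proj↦) ,
                         λ y → mk⇔ (λ _ → y , proj↦) (λ _ → _ , refl))
    ; surjective = decode-surjective
    ; eq         = code
    ; eq-maps    = λ { (k ∷ l ∷ []) _ →
                       _ , computes k l , isEqual-01 (crossProduct k l) (crossProduct l k) }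
    ; eq-true    = λ { {k} {l} refl refl d≡e → subst (code ∙ k ∷ l ∷ [] ↦_)
                         (isEqual-true (to (decode-≡⇔ k l) d≡e)) (computes k l) }
    ; eq-false   = λ { {k} {l} refl refl d≢e → subst (code ∙ k ∷ l ∷ [] ↦_)
                         (isEqual-false (d≢e ∘ from (decode-≡⇔ k l))) (computes k l) }
    }
  ; computable = decoding-binary _+_ sum-computable decode-sum ∷
                 decoding-binary _*_ product-computable decode-product ∷ []
  }
  where
  open Equivalence
  open Computable₂ sameFraction-computable

-- Translating between admissible indexings

-- The value at yes is 0 because mu searches for a zero.
distinct : {P : Set} → Dec P → ℕ
distinct (yes _) = 0
distinct (no  _) = 1

distinct≡0⇒ : {P : Set} (P? : Dec P) → distinct P? ≡ 0 → P
distinct≡0⇒ (yes p) _ = p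

⇒distinct≡0 : {P : Set} (P? : Dec P) → P → distinct P? ≡ 0
⇒distinct≡0 (yes _) _ = refl
⇒distinct≡0 (no ¬p) p = contradiction p ¬p

-- The cleared equation is tested instead of `q ≡ decode k` because it involves only sums, products
-- and naturals, which every admissible indexing can compute.
decodes? : ∀ q k →
  Dec (q * natural (suc (denominator-1 k)) + natural (numerator⁻ k) ≡ natural (numerator⁺ k))
decodes? q k =
  q * natural (suc (denominator-1 k)) + natural (numerator⁻ k) ℚ.≟ natural (numerator⁺ k)

decodes⇔ : ∀ q k → (distinct (decodes? q k) ≡ 0) ⇔ (q ≡ decode k)
decodes⇔ q k = mk⇔ (to equation ∘ distinct≡0⇒ (decodes? q k))
                   (⇒distinct≡0 (decodes? q k) ∘ from equation)
  where
  open Equivalence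
  equation = fraction-equation q (numerator⁺ k) (numerator⁻ k) (denominator-1 k)

-- The counterpart of `Computable` for values in `E`: the code returns some index of the value, no
-- particular one being prescribed.
record Realised (j : ℕ → E → Set) (φ : Vec ℕ n → E) : Set where
  constructor realised
  field
    code     : Code n
    realises : ∀ xs → (j ⊙ code) xs (φ xs)

record Realised₁ (j : ℕ → E → Set) (φ : ℕ → E) : Set where
  constructor realised₁
  field
    code     : Code 1
    realises : ∀ x → (j ⊙ code) [ x ] (φ x)

-- Computation relative to an admissible indexing

module Admissible {j} (adm : IsAdmissible ℚ-+-× j) where
  open IsAdmissible adm renaming (computable to operations)
  open IsIndexing isIndexing public

  private
    enumeration : ∃[ f ] Total f × (∀ y → Dom j y ⇔ (∃[ x ] f ∙ [ x ] ↦ y))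
    enumeration with enumerable
    -- An empty domain would leave 0 without an index.
    ... | inj₁ empty = contradiction (0ℚ , proj₂ (surjective 0ℚ)) (empty _)
    ... | inj₂ f     = f

  enumerator : Code 1
  enumerator = proj₁ enumeration

  index : ℕ → ℕ
  index x = proj₁ (proj₁ (proj₂ enumeration) x)

  enumerator-computes : ∀ x → enumerator ∙ [ x ] ↦ index x
  enumerator-computes x = proj₂ (proj₁ (proj₂ enumeration) x)

  private
    index∈Dom : ∀ x → Dom j (index x)
    index∈Dom x = Equivalence.from (proj₂ (proj₂ enumeration) _) (x , enumerator-computes x)

  -- `j` is partial, and its codes are unconstrained outside its domain. Composing it with the
  -- enumeration gives a total surjection, so the tests built on it are total and can be searched.
  element : ℕ → ℚ
  element x = proj₁ (index∈Dom x)

  index-element : ∀ x → j (index x) (element x)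
  index-element x = proj₂ (index∈Dom x)

  index-surjective : ∀ {y q} → j y q → ∃[ x ] index x ≡ y
  index-surjective {y} jyq with x , fx↦y ← Equivalence.to (proj₂ (proj₂ enumeration) y) (_ , jyq) =
    x , ↦-functional (enumerator-computes x) fx↦y

  element-surjective : ∀ q → ∃[ x ] element x ≡ q
  element-surjective q with y , jyq ← surjective q with x , refl ← index-surjective jyq =
    x , functional (index-element x) jyq

  element-realised : Realised₁ j element
  element-realised = realised₁ enumerator λ x → index x , enumerator-computes x , index-element x

  apply : ∀ {φ} {f : Vec ℕ n → ℕ} → Realised₁ j φ → Computable f → Realised j (λ xs → φ (f xs))
  apply (realised₁ c p) (computable d q) = realised (comp c (d ∷ [])) λ xs →
    let y , c↦y , jy = p _ in y , comp↦ (q xs ∷ []) c↦y , jy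

  const-realised : ∀ q → Realised {n = n} j (λ _ → q)
  const-realised q with y , jyq ← surjective q with computable c p ← const-computable y =
    realised c λ xs → y , p xs , jyq

  binary-realised : ∀ {_⊕_ : ℚ → ℚ → ℚ} {φ ψ : Vec ℕ n → ℚ} →
                    ComputableRelativelyTo j (binary _⊕_) →
                    Realised j φ → Realised j ψ → Realised j (λ xs → φ xs ⊕ ψ xs)
  binary-realised (c , _ , p) (realised d q) (realised e r) = realised (comp c (d ∷ e ∷ [])) λ xs →
    let x , d↦x , jx = q xs
        y , e↦y , jy = r xs
        z , c↦z , jz = p (jx ∷ jy ∷ [])
    in z , comp↦ (d↦x ∷ e↦y ∷ []) c↦z , jz

  _+ʳ_ : {φ ψ : Vec ℕ n → ℚ} → Realised j φ → Realised j ψ → Realised j (λ xs → φ xs + ψ xs)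
  _+ʳ_ = binary-realised {_⊕_ = _+_} (List.head operations)

  _*ʳ_ : {φ ψ : Vec ℕ n → ℚ} → Realised j φ → Realised j ψ → Realised j (λ xs → φ xs * ψ xs)
  _*ʳ_ = binary-realised {_⊕_ = _*_} (List.head (List.tail operations))

  -- Primitive recursion on indices: start from an index of 0, and at each step apply the code for
  -- addition to the current index and a fixed index of 1.
  natural-realised : Realised₁ j natural
  natural-realised = realised₁ code realises
    where
    zeroʳ = const-realised {0} 0ℚ
    oneʳ  = const-realised {2} 1ℚ
    code  = prec (Realised.code zeroʳ)
                 (comp (proj₁ (List.head operations)) (proj (suc zero) ∷ Realised.code oneʳ ∷ []))
    realises : ∀ k → (j ⊙ code) [ k ] (natural k)
    realises zero = let y , ↦y , jy = Realised.realises zeroʳ [] in y , prec↦₀ ↦y , jy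
    realises (suc k) =
      let x , ↦x , jx = realises k
          y , ↦y , jy = Realised.realises oneʳ (k ∷ x ∷ [])
          z , ↦z , jz = proj₂ (proj₂ (List.head operations)) (jx ∷ jy ∷ [])
      in z , prec↦ₛ ↦x (comp↦ (proj↦ ∷ ↦y ∷ []) ↦z) , subst (j z) (natural-suc k) jz

  -- `eq` answers 1 on equal elements, whereas the searches look for 0; composing with `isZero`
  -- exchanges the two answers.
  distinct-computable : {φ ψ : Vec ℕ n → ℚ} → Realised j φ → Realised j ψ →
                        Computable (λ xs → distinct (φ xs ℚ.≟ ψ xs))
  distinct-computable {φ = φ} {ψ} (realised d q) (realised e r) = computable _ computes
    where
    open Computable₁ isZero-computable renaming (code to z; computes to z-computes)
    computes : ∀ xs → comp z (comp eq (d ∷ e ∷ []) ∷ []) ∙ xs ↦ distinct (φ xs ℚ.≟ ψ xs)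
    computes xs with x , d↦x , jx ← q xs with y , e↦y , jy ← r xs with φ xs ℚ.≟ ψ xs
    ... | yes φ≡ψ = comp↦ (comp↦ (d↦x ∷ e↦y ∷ []) (eq-true jx jy φ≡ψ) ∷ []) (z-computes 1)
    ... | no  φ≢ψ = comp↦ (comp↦ (d↦x ∷ e↦y ∷ []) (eq-false jx jy φ≢ψ) ∷ []) (z-computes 0)

  decodes-computable : {φ : Vec ℕ n → ℚ} {f : Vec ℕ n → ℕ} → Realised j φ → Computable f →
                        Computable (λ xs → distinct (decodes? (φ xs) (f xs)))
  decodes-computable Φ F = distinct-computable
    ((Φ *ʳ apply natural-realised (apply₁ suc-computable (apply₁ denominator-1-computable F))) +ʳ
     apply natural-realised (apply₁ numerator⁻-computable F))
    (apply natural-realised (apply₁ numerator⁺-computable F))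

-- Translation by two successive searches

module Translation {j j′} (adm : IsAdmissible ℚ-+-× j) (adm′ : IsAdmissible ℚ-+-× j′) where
  private
    module J  = Admissible adm
    module J′ = Admissible adm′

  -- The first argument is the position sought in the enumeration of the domain of `j′`, the second
  -- the index to be found. The search halts exactly when that index lies in the domain.
  locate : Computable λ xs → ∣ J′.index (lookup xs zero) - lookup xs (suc zero) ∣
  locate = apply₂ distance-computable
    (apply₁ (computable₁ J′.enumerator J′.enumerator-computes) (var {2} zero)) (var (suc zero))

  -- The search variable codes a position in the enumeration for `j` and a fraction. The fraction is
  -- the intermediary, as each indexing tests equality only between its own indices. The sum of the
  -- two tests is 0 only if both are.
  match : Computable λ xs →
    distinct (decodes? (J′.element (lookup xs (suc zero))) (right (lookup xs zero))) ℕ.+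
    distinct (decodes? (J.element (left (lookup xs zero))) (right (lookup xs zero)))
  match =
    J′.decodes-computable (J′.apply J′.element-realised (var {2} (suc zero)))
                          (apply₁ right-computable (var zero)) +ᶜ
    J.decodes-computable (J.apply J.element-realised (apply₁ left-computable (var zero)))
                         (apply₁ right-computable (var zero))

  translate : Code 1
  translate = comp J.enumerator
    (comp (Computable₁.code left-computable)
      (comp (mu (Computable.code match)) (mu (Computable.code locate) ∷ []) ∷ []) ∷ [])

  locate-sound : ∀ {x e} → mu (Computable.code locate) ∙ [ x ] ↦ e → J′.index e ≡ x
  locate-sound = ℕ.∣m-n∣≡0⇒m≡n ∘ mu-sound locate

  -- A zero exists because `j` and `decode` are both surjective: `d` is a position of the element
  -- for `j`, and `m` codes a fraction equal to it.
  match-defined : ∀ e → ∃[ k ] mu (Computable.code match) ∙ [ e ] ↦ k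
  match-defined e
    with d , d≡ ← J.element-surjective (J′.element e)
    with m , m≡ ← decode-surjective (J′.element e)
    = mu-defined match [ e ] k
        (cong₂ ℕ._+_ (from (decodes⇔ (J′.element e) (right k)) (sym k≡))
                     (from (decodes⇔ (J.element (left k)) (right k))
                           (trans (cong J.element (left-pair d m)) (trans d≡ (sym k≡)))))
    where
    open Equivalence
    k = pair d m
    k≡ : decode (right k) ≡ J′.element e
    k≡ = trans (cong decode (right-pair d m)) m≡

  -- Both tests vanish, so both elements equal the fraction `decode (right k)`.
  match-sound : ∀ {e k} → mu (Computable.code match) ∙ [ e ] ↦ k → J.element (left k) ≡ J′.element e
  match-sound {e} {k} ↦k = trans
    (to (decodes⇔ (J.element (left k)) (right k)) (ℕ.m+n≡0⇒n≡0 test′ tests≡0))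
    (sym (to (decodes⇔ (J′.element e) (right k)) (ℕ.m+n≡0⇒m≡0 test′ tests≡0)))
    where
    open Equivalence
    test′ = distinct (decodes? (J′.element e) (right k))
    tests≡0 = mu-sound match ↦k

  translate-matching : ∀ {x e k q} → mu (Computable.code locate) ∙ [ x ] ↦ e →
                       mu (Computable.code match) ∙ [ e ] ↦ k → j′ x q → (j ⊙ translate) [ x ] q
  translate-matching {e = e} {k} ↦e ↦k j′xq =
    J.index (left k) ,
    comp↦ (comp↦ (comp↦ (↦e ∷ []) ↦k ∷ []) (Computable₁.computes left-computable k) ∷ [])
          (J.enumerator-computes (left k)) ,
    subst (j (J.index (left k))) element≡q (J.index-element (left k))
    where
    -- `locate` guarantees that position `e` holds the index `x`, and `j′` is single-valued, so the
    -- element at `e` is `q`.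
    element≡q = trans (match-sound ↦k)
      (J′.functional (J′.index-element e) (subst (λ y → j′ y _) (sym (locate-sound ↦e)) j′xq))

  translate-complete : ∀ {x q} → j′ x q → (j ⊙ translate) [ x ] q
  translate-complete {x} j′xq =
    let e₀ , e₀≡ = J′.index-surjective j′xq
        e  , ↦e  = mu-defined locate [ x ] e₀ (ℕ.m≡n⇒∣m-n∣≡0 e₀≡)
        k  , ↦k  = match-defined e
    in translate-matching ↦e ↦k j′xq

  -- A halting run contains a halting run of `locate`, so `x` has a value under `j′`, namely the
  -- element at `e`. By completeness and determinism the output `y` is an index of this element for
  -- `j`, and single-valuedness of `j` identifies it with `q`.
  translate-sound : ∀ {x q} → (j ⊙ translate) [ x ] q → j′ x q
  translate-sound {x} (y , ↦y@(comp↦ (comp↦ (comp↦ (_∷_ {y = e} ↦e []) _ ∷ []) _ ∷ []) _) , jyq) =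
    let j′xe           = subst (λ z → j′ z (J′.element e)) (locate-sound ↦e) (J′.index-element e)
        y′ , ↦y′ , jy′e = translate-complete j′xe
        jye            = subst (λ z → j z (J′.element e)) (↦-functional ↦y′ ↦y) jy′e
    in subst (j′ x) (J.functional jye jyq) j′xe

proposition6 : ComputabilityStable ℚ-+-×
proposition6 = (Decoding , decoding-isAdmissible) , λ j j′ adm adm′ →
  let open Translation adm adm′ in
  translate ,
  (λ { (x ∷ []) ((q , j′xq) ∷ []) →
       let y , ↦y , jyq = translate-complete j′xq in y , ↦y , q , jyq }) ,
  λ x q → mk⇔ translate-complete translate-sound
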